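{- For every integer $k>2^{100}$, we have $g(k)<2^{2000k}$. Equivalently, for $k>2^{100}$ and $n\ge 2^{2000k}$, every edge-coloring of the complete graph $K_n$ with $k$ colors contains a copy of $K_4$ whose six edges receive at most two distinct colors.
   Context: For a positive integer $k$, $g(k)$ denotes the largest positive integer $n$ for which there exists an edge-coloring of the complete graph $K_n$ using $k$ colors in which the edges of every copy of $K_4$ receive at least three distinct colors. -}

module Defs where

open import Data.Nat using (ℕ)
open import Data.Fin using (Fin)
open import Data.Product using (∃; ∃-syntax; _×_)
open import Data.Sum using (_⊎_)
open import Relation.Binary.PropositionalEquality using (_≡_; _≢_)

-- An edge-colouring of the complete graph K_n (vertex set Fin n) with k colours:
-- a colour for every pair of vertices, required to be symmetric; the values on
-- the diagonal (loops) are irrelevant and never inspected.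
record EdgeColoring (n k : ℕ) : Set where
  field
    col  : Fin n → Fin n → Fin k
    symm : ∀ i j → col i j ≡ col j i
open EdgeColoring public

_∈₂_,_ : ∀ {k} → Fin k → Fin k → Fin k → Set
x ∈₂ a , b = (x ≡ a) ⊎ (x ≡ b)

AtMostTwoColours : ∀ {n k} → EdgeColoring n k → Fin n → Fin n → Fin n → Fin n → Set
AtMostTwoColours χ a b c d =
  ∃[ x ] ∃[ y ]
    ( (col χ a b ∈₂ x , y) × (col χ a c ∈₂ x , y) × (col χ a d ∈₂ x , y)
    × (col χ b c ∈₂ x , y) × (col χ b d ∈₂ x , y) × (col χ c d ∈₂ x , y) )

Distinct4 : ∀ {n} → Fin n → Fin n → Fin n → Fin n → Set
Distinct4 a b c d =
  (a ≢ b) × (a ≢ c) × (a ≢ d) × (b ≢ c) × (b ≢ d) × (c ≢ d)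

HasBadK4 : ∀ {n k} → EdgeColoring n k → Set
HasBadK4 {n} χ =
  ∃[ a ] ∃[ b ] ∃[ c ] ∃[ d ] (Distinct4 {n} a b c d × AtMostTwoColours χ a b c d)

{-# OPTIONS --safe #-}

-- Suppose that no K₄ has at most two colours.  If T is a rainbow clique all of
-- whose vertices are joined to every vertex of X in one colour c, then no
-- colour of T occurs inside X: otherwise a 4-cycle in colour c and a matching
-- would form a two-coloured K₄.  Thus common neighbourhoods of rainbow cliques
-- of order t lose about t²/2 colours, and by induction on the number of colours
-- they are tiny.
--
-- Without a rainbow clique of order 2 ^ (m + 1), half of the vertices have in
-- some colour a degree of at least a 2 ^ -(3 m + 4) fraction, so one colour c
-- serves a set U of many vertices.  Dependent random choice then produces a
-- large subset of U in which all cliques of order 2 ^ m have large common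
-- c-neighbourhoods, hence none of them is rainbow.  Passing from cliques of
-- order 2 ^ (m + 1) to cliques of order 2 ^ m costs a factor whose exponent is
-- about k m / 2 ^ m for k colours, and these exponents add up to O(k).
module Submission where

open import Defs
open import Data.Empty using (⊥)
open import Data.Bool.Base using (true; false; if_then_else_)
open import Data.Fin.Base using (Fin; zero; suc)
import Data.Fin.Properties as Fin
open import Data.List.Base using (List; []; _∷_; _++_; length; map; filter; take; cartesianProductWith; allFin)
open import Data.List.Membership.Propositional using (_∈_; _∉_; find)
open import Data.List.Membership.Propositional.Properties using
  (∈-++⁻; ∈-++⁺ʳ; ∈-map⁻; ∈-filter⁺; ∈-filter⁻; ∈-length; ∈-allFin; ∈-cartesianProductWith⁺; ∈-cartesianProductWith⁻)
import Data.List.Membership.DecPropositional as DecMembership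
open import Data.List.Properties using
  (length-++; length-map; length-take; length-filter; length-tabulate; filter-reject)
open import Data.List.Relation.Binary.Disjoint.Propositional using (Disjoint)
open import Data.List.Relation.Unary.All as All using (All; []; _∷_)
import Data.List.Relation.Unary.All.Properties as Allₚ
open import Data.List.Relation.Unary.AllPairs using ([]; _∷_)
open import Data.List.Relation.Unary.Any using (here; there)
open import Data.List.Relation.Unary.Unique.Propositional using (Unique)
import Data.List.Relation.Unary.Unique.DecPropositional as DecUnique
import Data.List.Relation.Unary.Unique.Propositional.Properties as Uniqueₚ
open import Data.Nat hiding (_≟_)
open import Data.Nat.Properties hiding (_≟_)
open import Data.Nat.Tactic.RingSolver using (solve-∀)
open import Data.Product using (_×_; _,_; ∃-syntax; proj₁; proj₂)
open import Data.Sum using (_⊎_; inj₁; inj₂)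
open import Function using (_∘_)
open import Level using (0ℓ)
open import Relation.Binary.Definitions using (DecidableEquality)
open import Relation.Binary.PropositionalEquality using
  (_≡_; _≢_; refl; sym; trans; cong; cong₂; subst; module ≡-Reasoning)
open import Relation.Nullary using (¬_; Dec; yes; no; does; contradiction)
open import Relation.Nullary.Decidable using (toSum; ¬?; _×-dec_; _⊎-dec_)
open import Relation.Unary using (Pred; Decidable)

-- Sums and counting over lists

private variable
  A B : Set

∑ : List A → (A → ℕ) → ℕ
∑ []       f = 0
∑ (x ∷ xs) f = f x + ∑ xs f

∑-mono : ∀ (xs : List A) {f g} → (∀ {x} → x ∈ xs → f x ≤ g x) → ∑ xs f ≤ ∑ xs g
∑-mono []       f≤g = z≤n
∑-mono (x ∷ xs) f≤g = +-mono-≤ (f≤g (here refl)) (∑-mono xs (f≤g ∘ there))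

∑-const : ∀ (xs : List A) c → ∑ xs (λ _ → c) ≡ length xs * c
∑-const []       c = refl
∑-const (x ∷ xs) c = cong (c +_) (∑-const xs c)

∑-bound : ∀ (xs : List A) {f c} → (∀ {x} → x ∈ xs → f x ≤ c) → ∑ xs f ≤ length xs * c
∑-bound xs {c = c} f≤c = ≤-trans (∑-mono xs f≤c) (≤-reflexive (∑-const xs c))

∑-+ : ∀ (xs : List A) f g → ∑ xs (λ x → f x + g x) ≡ ∑ xs f + ∑ xs g
∑-+ []       f g = refl
∑-+ (x ∷ xs) f g = begin
  f x + g x + ∑ xs (λ x → f x + g x) ≡⟨ cong (f x + g x +_) (∑-+ xs f g) ⟩
  f x + g x + (∑ xs f + ∑ xs g)      ≡⟨ interchange (f x) (g x) (∑ xs f) (∑ xs g) ⟩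
  f x + ∑ xs f + (g x + ∑ xs g)      ∎
  where
  open ≡-Reasoning
  interchange : ∀ a b c d → a + b + (c + d) ≡ a + c + (b + d)
  interchange = solve-∀

∑-* : ∀ (xs : List A) f c → ∑ xs (λ x → f x * c) ≡ ∑ xs f * c
∑-* []       f c = refl
∑-* (x ∷ xs) f c = trans (cong (f x * c +_) (∑-* xs f c)) (sym (*-distribʳ-+ c (f x) _))

∑-swap : ∀ (xs : List A) (ys : List B) (f : A → B → ℕ) →
         ∑ xs (λ x → ∑ ys (f x)) ≡ ∑ ys (λ y → ∑ xs (λ x → f x y))
∑-swap []       ys f = sym (trans (∑-const ys 0) (*-zeroʳ (length ys)))
∑-swap (x ∷ xs) ys f = trans (cong (∑ ys (f x) +_) (∑-swap xs ys f)) (sym (∑-+ ys (f x) _))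

term≤∑ : ∀ {xs : List A} {x} f → x ∈ xs → f x ≤ ∑ xs f
term≤∑ {xs = y ∷ xs} f (here refl) = m≤m+n (f y) _
term≤∑ {xs = y ∷ xs} f (there x∈) = ≤-trans (term≤∑ f x∈) (m≤n+m _ (f y))

averaging : ∀ (xs : List A) f g → 0 < length xs → ∑ xs f ≤ ∑ xs g → ∃[ x ] x ∈ xs × f x ≤ g x
averaging (x ∷ xs) f g _ ∑f≤∑g with f x ≤? g x
... | yes fx≤gx = x , here refl , fx≤gx
... | no fx≰gx with xs
...   | [] = contradiction (subst (f x ≤_) (+-identityʳ _) (m+n≤o⇒m≤o (f x) ∑f≤∑g)) fx≰gx
...   | y ∷ ys with averaging (y ∷ ys) f g z<s
                     (≮⇒≥ λ ∑g<∑f → <⇒≱ (+-mono-< (≰⇒> fx≰gx) ∑g<∑f) ∑f≤∑g)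
...     | z , z∈ , fz≤gz = z , there z∈ , fz≤gz

⟦_⟧ : {P : Set} → Dec P → ℕ
⟦ P? ⟧ = if does P? then 1 else 0

⟦⟧-intro : {P : Set} (P? : Dec P) → P → 1 ≤ ⟦ P? ⟧
⟦⟧-intro (yes _) _ = ≤-refl
⟦⟧-intro (no ¬p) p = contradiction p ¬p

⟦⟧-elim : {P : Set} (P? : Dec P) → ¬ P → ⟦ P? ⟧ ≡ 0
⟦⟧-elim (yes p) ¬p = contradiction p ¬p
⟦⟧-elim (no _)  _  = refl

⟦⟧-mono : {P Q : Set} (P? : Dec P) (Q? : Dec Q) → (P → Q) → ⟦ P? ⟧ ≤ ⟦ Q? ⟧
⟦⟧-mono (yes p) Q? P⇒Q = ⟦⟧-intro Q? (P⇒Q p)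
⟦⟧-mono (no _)  Q? P⇒Q = z≤n

⟦⟧≤1 : {P : Set} (P? : Dec P) → ⟦ P? ⟧ ≤ 1
⟦⟧≤1 (yes _) = ≤-refl
⟦⟧≤1 (no _)  = z≤n

module _ {P : Pred A 0ℓ} (P? : Decidable P) where

  length-filter-∑ : ∀ xs → length (filter P? xs) ≡ ∑ xs (λ x → ⟦ P? x ⟧)
  length-filter-∑ [] = refl
  length-filter-∑ (x ∷ xs) with does (P? x)
  ... | true  = cong suc (length-filter-∑ xs)
  ... | false = length-filter-∑ xs

  ∑-filter-≤ : ∀ xs f → ∑ (filter P? xs) f ≤ ∑ xs f
  ∑-filter-≤ [] f = z≤n
  ∑-filter-≤ (x ∷ xs) f with does (P? x)
  ... | true  = +-monoʳ-≤ (f x) (∑-filter-≤ xs f)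
  ... | false = ≤-trans (∑-filter-≤ xs f) (m≤n+m _ (f x))

module UniqueCounting {A : Set} (_≟_ : DecidableEquality A) where
  open DecMembership _≟_ using (_∈?_; _∉?_)

  occurrences-absent : ∀ {x} xs → x ∉ xs → ∑ xs (λ y → ⟦ x ≟ y ⟧) ≡ 0
  occurrences-absent []       x∉ = refl
  occurrences-absent {x} (y ∷ xs) x∉ with x ≟ y
  ... | yes x≡y = contradiction (here x≡y) x∉
  ... | no _    = occurrences-absent xs (x∉ ∘ there)

  occurrences-unique : ∀ {x xs} → Unique xs → ∑ xs (λ y → ⟦ x ≟ y ⟧) ≤ 1
  occurrences-unique []         = z≤n
  occurrences-unique {x} {y ∷ xs} (y≢ ∷ u) with x ≟ y
  ... | yes refl = ≤-reflexive (cong suc (occurrences-absent xs (λ x∈ → All.lookup y≢ x∈ refl)))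
  ... | no _     = occurrences-unique u

  -- Double counting of coincidences: since `ys` has no repetitions, each entry of `zs` accounts for
  -- at most one lost entry.
  length-remove : ∀ {ys} zs → Unique ys → length ys ≤ length zs + length (filter (_∉? zs) ys)
  length-remove {ys} zs u = begin
    length ys                                                        ≡⟨ *-identityʳ _ ⟨
    length ys * 1                                                    ≡⟨ ∑-const ys 1 ⟨
    ∑ ys (λ _ → 1)                                                   ≤⟨ ∑-mono ys (λ {y} _ → cover y) ⟩
    ∑ ys (λ y → ∑ zs (λ z → ⟦ z ≟ y ⟧) + ⟦ y ∉? zs ⟧)                ≡⟨ ∑-+ ys _ _ ⟩
    ∑ ys (λ y → ∑ zs (λ z → ⟦ z ≟ y ⟧)) + ∑ ys (λ y → ⟦ y ∉? zs ⟧)   ≡⟨ cong₂ _+_ (∑-swap ys zs _) (sym (length-filter-∑ (_∉? zs) ys)) ⟩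
    ∑ zs (λ z → ∑ ys (λ y → ⟦ z ≟ y ⟧)) + length (filter (_∉? zs) ys) ≤⟨ +-monoˡ-≤ _ (∑-bound zs (λ _ → occurrences-unique u)) ⟩
    length zs * 1 + length (filter (_∉? zs) ys)                      ≡⟨ cong₂ _+_ (*-identityʳ (length zs)) refl ⟩
    length zs + length (filter (_∉? zs) ys)                          ∎
    where
    open ≤-Reasoning
    cover : ∀ y → 1 ≤ ∑ zs (λ z → ⟦ z ≟ y ⟧) + ⟦ y ∉? zs ⟧
    cover y with toSum (y ∈? zs)
    ... | inj₁ y∈ = ≤-trans (≤-trans (⟦⟧-intro (y ≟ y) refl) (term≤∑ (λ z → ⟦ z ≟ y ⟧) y∈)) (m≤m+n _ _)
    ... | inj₂ y∉ = ≤-trans (⟦⟧-intro (y ∉? zs) y∉) (m≤n+m _ (∑ zs _))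

  -- Here the repetition-free list is the smaller one, so each entry of `ys` is charged at most
  -- once, either by `xs` or by the filter. This counts the colours left over by a rainbow clique.
  length-unique-⊆ : ∀ {xs} ys → Unique xs → (∀ {x} → x ∈ xs → x ∈ ys) →
                    length xs + length (filter (_∉? xs) ys) ≤ length ys
  length-unique-⊆ {xs} ys u xs⊆ys = begin
    length xs + length (filter (_∉? xs) ys)                          ≡⟨ cong₂ _+_ (trans (∑-const xs 1) (*-identityʳ _)) (sym (length-filter-∑ (_∉? xs) ys)) ⟨
    ∑ xs (λ _ → 1) + ∑ ys (λ y → ⟦ y ∉? xs ⟧)                        ≤⟨ +-monoˡ-≤ _ (∑-mono xs λ {x} x∈ → ≤-trans (⟦⟧-intro (x ≟ x) refl) (term≤∑ (λ y → ⟦ y ≟ x ⟧) (xs⊆ys x∈))) ⟩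
    ∑ xs (λ x → ∑ ys (λ y → ⟦ y ≟ x ⟧)) + ∑ ys (λ y → ⟦ y ∉? xs ⟧)   ≡⟨ cong₂ _+_ (∑-swap xs ys _) refl ⟩
    ∑ ys (λ y → ∑ xs (λ x → ⟦ y ≟ x ⟧)) + ∑ ys (λ y → ⟦ y ∉? xs ⟧)   ≡⟨ ∑-+ ys _ _ ⟨
    ∑ ys (λ y → ∑ xs (λ x → ⟦ y ≟ x ⟧) + ⟦ y ∉? xs ⟧)                ≤⟨ ∑-bound ys (λ {y} _ → single y) ⟩
    length ys * 1                                                    ≡⟨ *-identityʳ _ ⟩
    length ys                                                        ∎
    where
    open ≤-Reasoning
    single : ∀ y → ∑ xs (λ x → ⟦ y ≟ x ⟧) + ⟦ y ∉? xs ⟧ ≤ 1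
    single y with toSum (y ∈? xs)
    ... | inj₁ y∈ = ≤-trans (≤-reflexive (trans (cong₂ _+_ refl (⟦⟧-elim (y ∉? xs) (λ y∉ → y∉ y∈))) (+-identityʳ _)))
                           (occurrences-unique u)
    ... | inj₂ y∉ = ≤-trans (≤-reflexive (cong₂ _+_ (occurrences-absent xs y∉) refl)) (⟦⟧≤1 (y ∉? xs))

unique-++⁻ : {A : Set} (xs {ys} : List A) → Unique (xs ++ ys) → Unique xs × Disjoint xs ys
unique-++⁻ []       u        = [] , λ ()
unique-++⁻ (x ∷ xs) (x≢ ∷ u) with unique-++⁻ xs u
... | uxs , disj = Allₚ.++⁻ˡ xs x≢ ∷ uxs , λ where
  (here refl , x∈ys) → All.lookup x≢ (∈-++⁺ʳ xs x∈ys) refl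
  (there v∈  , v∈ys) → disj (v∈ , v∈ys)

-- Rainbow cliques

module Rainbows {V C : Set} (_≟_ : DecidableEquality C)
  (χ : V → V → C) (χ-sym : ∀ u v → χ u v ≡ χ v u) (o : C) where

  -- o is the colour of loops; seeding with it makes Rainbow T force the
  -- vertices of T to be distinct.
  cols : List V → List C
  cols []      = o ∷ []
  cols (v ∷ T) = map (χ v) T ++ cols T

  Rainbow : List V → Set
  Rainbow T = Unique (cols T)

  rainbow? : Decidable Rainbow
  rainbow? T = DecUnique.unique? _≟_ (cols T)

  length-cols-∷ : ∀ v T → length (cols (v ∷ T)) ≡ length T + length (cols T)
  length-cols-∷ v T = trans (length-++ (map (χ v) T)) (cong (_+ length (cols T)) (length-map (χ v) T))

  -- This encodes 1 + t (t - 1) / 2 without subtraction or division; the extra colour is the seed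
  -- `o`.
  length-cols : ∀ T → 2 * length (cols T) + length T ≡ 2 + length T * length T
  length-cols []      = refl
  length-cols (v ∷ T) = begin
    2 * length (cols (v ∷ T)) + suc t ≡⟨ cong (λ l → 2 * l + suc t) (length-cols-∷ v T) ⟩
    2 * (t + c) + suc t               ≡⟨ regroup t c ⟩
    1 + 2 * t + (2 * c + t)           ≡⟨ cong (1 + 2 * t +_) (length-cols T) ⟩
    1 + 2 * t + (2 + t * t)           ≡⟨ square t ⟩
    2 + suc t * suc t                 ∎
    where
    open ≡-Reasoning
    t = length T
    c = length (cols T)
    regroup : ∀ t c → 2 * (t + c) + suc t ≡ 1 + 2 * t + (2 * c + t)
    regroup = solve-∀
    square : ∀ t → 1 + 2 * t + (2 + t * t) ≡ 2 + suc t * suc t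
    square = solve-∀

  length-cols-≤ : ∀ T → length (cols T) ≤ 1 + length T * length T
  length-cols-≤ []      = ≤-refl
  length-cols-≤ (v ∷ T) = begin
    length (cols (v ∷ T)) ≡⟨ length-cols-∷ v T ⟩
    t + length (cols T)   ≤⟨ +-monoʳ-≤ t (length-cols-≤ T) ⟩
    t + (1 + t * t)       ≤⟨ m≤m+n _ (1 + t) ⟩
    t + (1 + t * t) + (1 + t) ≡⟨ square t ⟩
    1 + suc t * suc t     ∎
    where
    open ≤-Reasoning
    t = length T
    square : ∀ t → t + (1 + t * t) + (1 + t) ≡ 1 + suc t * suc t
    square = solve-∀

  -- Both one-vertex extensions of `T` are rainbow already, so only new coincidences can do harm:
  -- the edge between `w` and `v` against all others, and edges from `w` to `T` against edges from
  -- `v` to `T`.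
  rainbow-∷∷ : ∀ {w v T} → Rainbow (w ∷ T) → Rainbow (v ∷ T) → χ v w ∉ cols (v ∷ T) →
               (∀ {u} → u ∈ T → χ w v ≢ χ w u) →
               (∀ {u u′} → u ∈ T → u′ ∈ T → χ u w ≢ χ v u′) →
               Rainbow (w ∷ v ∷ T)
  rainbow-∷∷ {w} {v} {T} rw rv new apart cross =
    Allₚ.++⁺ (Allₚ.map⁺ (All.tabulate apart))
             (All.tabulate λ e∈ wv≡e → new (subst (_∈ cols (v ∷ T)) (trans (sym wv≡e) (χ-sym w v)) e∈))
    ∷ Uniqueₚ.++⁺ (proj₁ split) rv disjoint
    where
    split = unique-++⁻ (map (χ w) T) rw
    disjoint : Disjoint (map (χ w) T) (cols (v ∷ T))
    disjoint (e∈w , e∈) with ∈-++⁻ (map (χ v) T) e∈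
    ... | inj₂ e∈T = proj₂ split (e∈w , e∈T)
    ... | inj₁ e∈v with ∈-map⁻ (χ w) e∈w | ∈-map⁻ (χ v) e∈v
    ...   | u , u∈ , refl | u′ , u′∈ , eq = cross u∈ u′∈ (trans (χ-sym u w) eq)

  star : List V → V → C → ℕ
  star B u e = ∑ B (λ w → ⟦ χ u w ≟ e ⟧)

  -- T is extended by a vertex v of the pool B of possible extensions.  Averaging
  -- over v bounds the only loss not controlled by stars at v or in T: the w
  -- with χ w v ≡ χ w u for some u in T.
  module Greedy (Δ : ℕ) (Q : V → Set) where

    conflicts : V → List V → V → ℕ
    conflicts v T w = ∑ (cols (v ∷ T)) (λ e → ⟦ χ v w ≟ e ⟧)
                    + ∑ T (λ u → ⟦ χ w v ≟ χ w u ⟧)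
                    + ∑ T (λ u → ∑ T (λ u′ → ⟦ χ u w ≟ χ v u′ ⟧))

    conflict-free : ∀ {v T w} → Rainbow (w ∷ T) → Rainbow (v ∷ T) →
                    conflicts v T w ≡ 0 → Rainbow (w ∷ v ∷ T)
    conflict-free {v} {T} {w} rw rv none = rainbow-∷∷ {T = T} rw rv
      (λ e∈ → absent (term≤∑ (λ e → ⟦ χ v w ≟ e ⟧) e∈) (⟦⟧-intro (_ ≟ _) refl) (m+n≡0⇒m≡0 _ none₁))
      (λ u∈ eq → absent (term≤∑ (λ u → ⟦ χ w v ≟ χ w u ⟧) u∈) (⟦⟧-intro (_ ≟ _) eq)
                        (m+n≡0⇒n≡0 (∑ (cols (v ∷ T)) _) none₁))
      (λ {u} u∈ u′∈ eq → absent (≤-trans (term≤∑ (λ u′ → ⟦ χ u w ≟ χ v u′ ⟧) u′∈)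
                                          (term≤∑ (λ u → ∑ T (λ u′ → ⟦ χ u w ≟ χ v u′ ⟧)) u∈))
                                (⟦⟧-intro (_ ≟ _) eq)
                                (m+n≡0⇒n≡0 (∑ (cols (v ∷ T)) _ + ∑ T _) none))
      where
      none₁ = m+n≡0⇒m≡0 (∑ (cols (v ∷ T)) _ + ∑ T _) none
      absent : ∀ {a b} → a ≤ b → 1 ≤ a → b ≢ 0
      absent a≤b 1≤a refl = contradiction (≤-trans 1≤a a≤b) λ ()

    -- The lost vertices lie in few stars: at most 1 + t + t² stars at `v`, one for each colour of
    -- the new clique, and t² stars at vertices of `T`, one for each pair `u`, `u′`. The remaining t
    -- Δ comes from `few`.
    pool-loss : ∀ {v T} B → Q v → All Q T → Rainbow (v ∷ T) → All (λ w → Rainbow (w ∷ T)) B →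
                (∀ {u} → Q u → ∀ e → star B u e ≤ Δ) →
                ∑ B (λ w → ∑ T (λ u → ⟦ χ w v ≟ χ w u ⟧)) ≤ length T * Δ →
                length B ≤ length (filter (λ w → rainbow? (w ∷ v ∷ T)) B)
                         + (1 + 2 * length T + 2 * (length T * length T)) * Δ
    pool-loss {v} {T} B qv qT rv rB stars few = begin
      length B                                              ≡⟨ *-identityʳ _ ⟨
      length B * 1                                          ≡⟨ ∑-const B 1 ⟨
      ∑ B (λ _ → 1)                                         ≤⟨ ∑-mono B cover ⟩
      ∑ B (λ w → ⟦ good w ⟧ + conflicts v T w)              ≡⟨ ∑-+ B _ _ ⟩
      ∑ B (λ w → ⟦ good w ⟧) + ∑ B (conflicts v T)          ≡⟨ cong₂ _+_ (sym (length-filter-∑ good B)) (trans (∑-+ B _ _) (cong₂ _+_ (∑-+ B _ _) refl)) ⟩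
      length (filter good B) + (∑ B (λ w → ∑ (cols (v ∷ T)) (λ e → ⟦ χ v w ≟ e ⟧))
                    + ∑ B (λ w → ∑ T (λ u → ⟦ χ w v ≟ χ w u ⟧))
                    + ∑ B (λ w → ∑ T (λ u → ∑ T (λ u′ → ⟦ χ u w ≟ χ v u′ ⟧))))
                                                            ≤⟨ +-monoʳ-≤ (length (filter good B)) (+-mono-≤ (+-mono-≤ loss₁ few) loss₃) ⟩
      length (filter good B) + ((1 + t + t * t) * Δ + t * Δ + t * (t * Δ)) ≡⟨ cong (length (filter good B) +_) (collect t Δ) ⟩
      length (filter good B) + (1 + 2 * t + 2 * (t * t)) * Δ ∎
      where
      open ≤-Reasoning
      t = length T
      good = λ w → rainbow? (w ∷ v ∷ T)
      collect : ∀ t Δ → (1 + t + t * t) * Δ + t * Δ + t * (t * Δ) ≡ (1 + 2 * t + 2 * (t * t)) * Δ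
      collect = solve-∀
      cover : ∀ {w} → w ∈ B → 1 ≤ ⟦ good w ⟧ + conflicts v T w
      cover {w} w∈ with conflicts v T w in eq
      ... | zero  = ≤-trans (⟦⟧-intro (good w) (conflict-free {T = T} (All.lookup rB w∈) rv eq)) (m≤m+n _ _)
      ... | suc c = ≤-trans (s≤s z≤n) (m≤n+m (suc c) _)
      loss₁ : ∑ B (λ w → ∑ (cols (v ∷ T)) (λ e → ⟦ χ v w ≟ e ⟧)) ≤ (1 + t + t * t) * Δ
      loss₁ = begin
        ∑ B (λ w → ∑ (cols (v ∷ T)) (λ e → ⟦ χ v w ≟ e ⟧)) ≡⟨ ∑-swap B (cols (v ∷ T)) _ ⟩
        ∑ (cols (v ∷ T)) (star B v)                         ≤⟨ ∑-bound (cols (v ∷ T)) (λ {e} _ → stars qv e) ⟩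
        length (cols (v ∷ T)) * Δ                           ≤⟨ *-monoˡ-≤ Δ (≤-trans (≤-reflexive (length-cols-∷ v T)) (+-monoʳ-≤ t (length-cols-≤ T))) ⟩
        (t + (1 + t * t)) * Δ                               ≡⟨ cong (_* Δ) (+-suc t (t * t)) ⟩
        (1 + t + t * t) * Δ                                 ∎
      loss₃ : ∑ B (λ w → ∑ T (λ u → ∑ T (λ u′ → ⟦ χ u w ≟ χ v u′ ⟧))) ≤ t * (t * Δ)
      loss₃ = begin
        ∑ B (λ w → ∑ T (λ u → ∑ T (λ u′ → ⟦ χ u w ≟ χ v u′ ⟧))) ≡⟨ ∑-swap B T _ ⟩
        ∑ T (λ u → ∑ B (λ w → ∑ T (λ u′ → ⟦ χ u w ≟ χ v u′ ⟧))) ≤⟨ ∑-bound T (λ {u} u∈ → begin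
          ∑ B (λ w → ∑ T (λ u′ → ⟦ χ u w ≟ χ v u′ ⟧)) ≡⟨ ∑-swap B T _ ⟩
          ∑ T (λ u′ → star B u (χ v u′))              ≤⟨ ∑-bound T (λ {u′} _ → stars (All.lookup qT u∈) (χ v u′)) ⟩
          t * Δ                                       ∎) ⟩
        t * (t * Δ)                                             ∎

    -- Exchange the sums and average over `v`: for fixed `w` and `u`, the vertices `v` with
    -- `χ w v ≡ χ w u` form a star at `w`, whose size is bounded because `w` lies in the pool.
    few-cherries : ∀ T B → All Q B → 0 < length B → (∀ {u} → Q u → ∀ e → star B u e ≤ Δ) →
                   ∃[ v ] v ∈ B × ∑ B (λ w → ∑ T (λ u → ⟦ χ w v ≟ χ w u ⟧)) ≤ length T * Δ
    few-cherries T B qB B≢[] stars = averaging B _ (λ _ → length T * Δ) B≢[] (begin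
      ∑ B (λ v → ∑ B (λ w → ∑ T (λ u → ⟦ χ w v ≟ χ w u ⟧))) ≡⟨ ∑-swap B B _ ⟩
      ∑ B (λ w → ∑ B (λ v → ∑ T (λ u → ⟦ χ w v ≟ χ w u ⟧))) ≤⟨ ∑-mono B (λ {w} w∈ → begin
        ∑ B (λ v → ∑ T (λ u → ⟦ χ w v ≟ χ w u ⟧)) ≡⟨ ∑-swap B T _ ⟩
        ∑ T (λ u → star B w (χ w u))              ≤⟨ ∑-bound T (λ {u} _ → stars (All.lookup qB w∈) (χ w u)) ⟩
        length T * Δ                              ∎) ⟩
      ∑ B (λ _ → length T * Δ) ∎)
      where open ≤-Reasoning

    -- Adding a vertex to a clique of order t costs (1 + 2t + 2t²) Δ pool vertices, which is at most
    -- ((t + 1)³ - t³) Δ. Hence the cubic inequality is an invariant.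
    grow : ∀ j T B → All Q T → All Q B → (∀ {u} → Q u → ∀ e → star B u e ≤ Δ) →
           Rainbow T → All (λ w → Rainbow (w ∷ T)) B →
           (length T + j) ^ 3 * Δ < length B + length T ^ 3 * Δ →
           ∃[ T′ ] All Q T′ × length T′ ≡ length T + j × Rainbow T′
    grow zero    T B qT qB stars rT rB big = T , qT , sym (+-identityʳ _) , rT
    grow (suc j) T B qT qB stars rT rB big
      with few-cherries T B qB
             -- The pool is nonempty because t³ ≤ (t + suc j)³ in `big`.
             (+-cancelʳ-< _ 0 (length B) (≤-<-trans (*-monoˡ-≤ Δ (^-monoˡ-≤ 3 (m≤m+n (length T) (suc j)))) big))
             stars
    ... | v , v∈ , few
      with grow j (v ∷ T) (filter good B) (All.lookup qB v∈ ∷ qT) (Allₚ.filter⁺ good qB)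
                (λ qu e → ≤-trans (∑-filter-≤ good B _) (stars qu e))
                (All.lookup rB v∈) (Allₚ.all-filter good B) big′
      where
      good = λ w → rainbow? (w ∷ v ∷ T)
      t = length T
      open ≤-Reasoning
      cube : ∀ t Δ → (1 + 2 * t + 2 * (t * t)) * Δ + t * (t * (t * 1)) * Δ + (t + t * t) * Δ
                   ≡ suc t * (suc t * (suc t * 1)) * Δ
      cube = solve-∀
      big′ : (suc t + j) ^ 3 * Δ < length (filter good B) + suc t ^ 3 * Δ
      big′ = begin-strict
        (suc t + j) ^ 3 * Δ       ≡⟨ cong (λ i → i ^ 3 * Δ) (+-suc t j) ⟨
        (t + suc j) ^ 3 * Δ       <⟨ big ⟩
        length B + t ^ 3 * Δ      ≤⟨ +-monoˡ-≤ (t ^ 3 * Δ) (pool-loss B (All.lookup qB v∈) qT (All.lookup rB v∈) rB stars few) ⟩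
        length (filter good B) + (1 + 2 * t + 2 * (t * t)) * Δ + t ^ 3 * Δ ≡⟨ +-assoc (length (filter good B)) _ _ ⟩
        length (filter good B) + ((1 + 2 * t + 2 * (t * t)) * Δ + t ^ 3 * Δ) ≤⟨ +-monoʳ-≤ (length (filter good B)) (≤-trans (m≤m+n _ _) (≤-reflexive (cube t Δ))) ⟩
        length (filter good B) + suc t ^ 3 * Δ ∎
    ... | T′ , qT′ , len , rT′ = T′ , qT′ , trans len (sym (+-suc (length T) j)) , rT′

  rainbow-of-bounded-stars : ∀ t Δ B → (∀ {u} → u ∈ B → ∀ e → star B u e ≤ Δ) →
    t ^ 3 * Δ < length B → ∃[ T ] All (_∈ B) T × length T ≡ t × Rainbow T
  rainbow-of-bounded-stars t Δ B stars big =
    Greedy.grow Δ (_∈ B) t [] B [] (All.tabulate λ x → x) stars ([] ∷ [])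
      (All.tabulate λ _ → [] ∷ []) (subst (t ^ 3 * Δ <_) (sym (+-identityʳ _)) big)

-- Dependent random choice

module DependentChoice {V : Set} {_~_ : V → V → Set} (_~?_ : ∀ y z → Dec (y ~ z)) (W : List V) where

  common? : ∀ T z → Dec (All (_~ z) T)
  common? T z = All.all? (_~? z) T

  degree : V → ℕ
  degree y = ∑ W (λ z → ⟦ y ~? z ⟧)

  codegree : List V → ℕ
  codegree T = ∑ W (λ z → ⟦ common? T z ⟧)

  -- One vertex z is chosen at a time; averaging over z keeps the inequality
  -- |Ts| / pˢ + R ≤ |Ys| / qˢ, here cleared of denominators.
  dependent-choice : ∀ s {p q R} .{{_ : NonZero p}} .{{_ : NonZero q}} Ys Ts → Unique Ys → 0 < length W →
    All (λ y → length W ≤ degree y * q) Ys →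
    All (λ T → codegree T * p ≤ length W) Ts →
    length Ts * q ^ s + R * (p ^ s * q ^ s) ≤ length Ys * p ^ s →
    ∃[ Ys′ ] ∃[ Ts′ ] Unique Ys′ × All (_∈ Ys) Ys′ ×
      (∀ {T} → T ∈ Ts → All (_∈ Ys′) T → T ∈ Ts′) × length Ts′ + R ≤ length Ys′
  dependent-choice zero {R = R} Ys Ts u _ _ _ big =
    Ys , Ts , u , All.tabulate (λ y∈ → y∈) , (λ T∈ _ → T∈) ,
    subst (length Ts + R ≤_) (*-identityʳ _)
      (subst (_≤ length Ys * 1) (cong₂ _+_ (*-identityʳ (length Ts)) (*-identityʳ R)) big)
  dependent-choice (suc s) {p} {q} {R} Ys Ts u W≢[] rich poor big
    with averaging W f g W≢[] (*-cancelʳ-≤ (∑ W f) (∑ W g) (p * q) {{m*n≢0 p q}} average)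
    where
    open ≤-Reasoning
    n = length W
    -- `f z ≤ g z` is the hypothesis `big` for the `s` remaining choices once `z` has been chosen.
    f = λ z → length (filter (λ T → common? T z) Ts) * q ^ s + R * (p ^ s * q ^ s)
    g = λ z → length (filter (_~? z) Ys) * p ^ s

    ∑-codegree : ∑ W (λ z → length (filter (λ T → common? T z) Ts)) * p ≤ length Ts * n
    ∑-codegree = begin
      ∑ W (λ z → length (filter (λ T → common? T z) Ts)) * p ≤⟨ *-monoˡ-≤ p (∑-mono W λ {z} _ → ≤-reflexive (length-filter-∑ (λ T → common? T z) Ts)) ⟩
      ∑ W (λ z → ∑ Ts (λ T → ⟦ common? T z ⟧)) * p           ≡⟨ cong (_* p) (∑-swap W Ts _) ⟩
      ∑ Ts codegree * p                                      ≡⟨ ∑-* Ts codegree p ⟨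
      ∑ Ts (λ T → codegree T * p)                            ≤⟨ ∑-bound Ts (All.lookup poor) ⟩
      length Ts * n                                          ∎

    ∑-degree : length Ys * n ≤ ∑ W (λ z → length (filter (_~? z) Ys)) * q
    ∑-degree = begin
      length Ys * n                                      ≡⟨ ∑-const Ys n ⟨
      ∑ Ys (λ _ → n)                                     ≤⟨ ∑-mono Ys (All.lookup rich) ⟩
      ∑ Ys (λ y → degree y * q)                          ≡⟨ ∑-* Ys degree q ⟩
      ∑ Ys degree * q                                    ≡⟨ cong (_* q) (∑-swap Ys W _) ⟩
      ∑ W (λ z → ∑ Ys (λ y → ⟦ y ~? z ⟧)) * q            ≤⟨ *-monoˡ-≤ q (∑-mono W λ {z} _ → ≤-reflexive (sym (length-filter-∑ (_~? z) Ys))) ⟩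
      ∑ W (λ z → length (filter (_~? z) Ys)) * q         ∎

    regroup₁ : ∀ a n R P Q p q → (a * Q + n * (R * (P * Q))) * (p * q) ≡ a * p * (q * Q) + n * (R * ((p * P) * (q * Q)))
    regroup₁ = solve-∀
    regroup₂ : ∀ a n b → a * n * b ≡ n * (a * b)
    regroup₂ = solve-∀
    regroup₃ : ∀ a P p q → a * q * (p * P) ≡ a * P * (p * q)
    regroup₃ = solve-∀

    -- The factor p q clears denominators: on average over `z`, the list `Ts` shrinks at least by a
    -- factor p and `Ys` at most by a factor q.
    average : ∑ W f * (p * q) ≤ ∑ W g * (p * q)
    average = begin
      ∑ W f * (p * q)
        ≡⟨ cong (_* (p * q)) (trans (∑-+ W _ _) (cong₂ _+_ (∑-* W _ (q ^ s)) (∑-const W _))) ⟩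
      (∑ W (λ z → length (filter (λ T → common? T z) Ts)) * q ^ s + n * (R * (p ^ s * q ^ s))) * (p * q)
        ≡⟨ regroup₁ (∑ W (λ z → length (filter (λ T → common? T z) Ts))) n R (p ^ s) (q ^ s) p q ⟩
      ∑ W (λ z → length (filter (λ T → common? T z) Ts)) * p * q ^ suc s + n * (R * (p ^ suc s * q ^ suc s))
        ≤⟨ +-monoˡ-≤ _ (*-monoˡ-≤ (q ^ suc s) ∑-codegree) ⟩
      length Ts * n * q ^ suc s + n * (R * (p ^ suc s * q ^ suc s))
        ≡⟨ cong₂ _+_ (regroup₂ (length Ts) n (q ^ suc s)) refl ⟩
      n * (length Ts * q ^ suc s) + n * (R * (p ^ suc s * q ^ suc s))
        ≡⟨ *-distribˡ-+ n _ _ ⟨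
      n * (length Ts * q ^ suc s + R * (p ^ suc s * q ^ suc s))
        ≤⟨ *-monoʳ-≤ n big ⟩
      n * (length Ys * p ^ suc s)
        ≡⟨ regroup₂ (length Ys) n (p ^ suc s) ⟨
      length Ys * n * p ^ suc s
        ≤⟨ *-monoˡ-≤ (p ^ suc s) ∑-degree ⟩
      ∑ W (λ z → length (filter (_~? z) Ys)) * q * p ^ suc s
        ≡⟨ regroup₃ (∑ W (λ z → length (filter (_~? z) Ys))) (p ^ s) p q ⟩
      ∑ W (λ z → length (filter (_~? z) Ys)) * p ^ s * (p * q)
        ≡⟨ cong (_* (p * q)) (∑-* W _ (p ^ s)) ⟨
      ∑ W g * (p * q) ∎
  ... | z , _ , big′
    with dependent-choice s (filter (_~? z) Ys) (filter (λ T → common? T z) Ts)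
           (Uniqueₚ.filter⁺ (_~? z) u) W≢[] (Allₚ.filter⁺ (_~? z) rich) (Allₚ.filter⁺ (λ T → common? T z) poor) big′
  ... | Ys′ , Ts′ , u′ , sub , keep , done =
    Ys′ , Ts′ , u′ , All.map (proj₁ ∘ ∈-filter⁻ (_~? z)) sub ,
    (λ T∈ T⊆ → keep (∈-filter⁺ (λ T → common? T z) T∈
                      (All.map (λ y∈ → proj₂ (∈-filter⁻ (_~? z) {xs = Ys} (All.lookup sub y∈))) T⊆)) T⊆) ,
    done

-- Tuples, truncations and heads of lists

tuples : {A : Set} → ℕ → List A → List (List A)
tuples zero    xs = [] ∷ []
tuples (suc t) xs = cartesianProductWith _∷_ xs (tuples t xs)

length-cartesianProductWith : {A B C : Set} (f : A → B → C) (xs : List A) (ys : List B) →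
  length (cartesianProductWith f xs ys) ≡ length xs * length ys
length-cartesianProductWith f []       ys = refl
length-cartesianProductWith f (x ∷ xs) ys =
  trans (length-++ (map (f x) ys)) (cong₂ _+_ (length-map (f x) ys) (length-cartesianProductWith f xs ys))

length-tuples : {A : Set} (t : ℕ) (xs : List A) → length (tuples t xs) ≡ length xs ^ t
length-tuples zero    xs = refl
length-tuples (suc t) xs =
  trans (length-cartesianProductWith _∷_ xs (tuples t xs)) (cong (length xs *_) (length-tuples t xs))

∈-tuples⁺ : {A : Set} {xs T : List A} → All (_∈ xs) T → T ∈ tuples (length T) xs
∈-tuples⁺ []        = here refl
∈-tuples⁺ (x∈ ∷ T⊆) = ∈-cartesianProductWith⁺ _∷_ x∈ (∈-tuples⁺ T⊆)

∈-tuples⁻ : {A : Set} (t : ℕ) {xs T : List A} → T ∈ tuples t xs → length T ≡ t × All (_∈ xs) T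
∈-tuples⁻ zero    (here refl) = refl , []
∈-tuples⁻ (suc t) {xs} T∈ with ∈-cartesianProductWith⁻ _∷_ xs (tuples t xs) T∈
... | x , T , x∈ , T∈′ , refl with ∈-tuples⁻ t T∈′
...   | len , T⊆ = cong suc len , x∈ ∷ T⊆

∈-take⁻ : {A : Set} (n : ℕ) {xs : List A} {x : A} → x ∈ take n xs → x ∈ xs
∈-take⁻ n {xs} = All.lookup (Allₚ.take⁺ n (All.tabulate {xs = xs} (λ x∈ → x∈)))

length-take-≤ : {A : Set} {n : ℕ} (xs : List A) → n ≤ length xs → length (take n xs) ≡ n
length-take-≤ {n = n} xs n≤ = trans (length-take n xs) (m≤n⇒m⊓n≡m n≤)

-- Deleting one vertex of each bad clique destroys all of them, at a cost of at most one vertex per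
-- clique.
heads : {A : Set} (Ts : List (List A)) →
        ∃[ H ] length H ≤ length Ts × (∀ {v T} → v ∷ T ∈ Ts → v ∈ H)
heads []             = [] , z≤n , λ ()
heads ([] ∷ Ts)      with heads Ts
... | H , len , hit = H , m≤n⇒m≤1+n len , λ { (there T∈) → hit T∈ }
heads ((v ∷ _) ∷ Ts) with heads Ts
... | H , len , hit = v ∷ H , s≤s len , λ { (here refl) → here refl ; (there T∈) → there (hit T∈) }

-- Estimates for powers of two

square≤2^ : ∀ n → suc n * suc n ≤ 4 * 2 ^ n
square≤2^ zero    = s≤s z≤n
square≤2^ (suc n) = begin
  suc (suc n) * suc (suc n)             ≡⟨ expand n ⟩
  suc n * suc n + (2 * suc n + 1)       ≤⟨ +-mono-≤ (square≤2^ n) (+-mono-≤ (*-monoʳ-≤ 2 (n<2^n n)) (≤-trans (m^n>0 2 n) (m≤n*m (2 ^ n) 2))) ⟩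
  4 * 2 ^ n + (2 * 2 ^ n + 2 * 2 ^ n)   ≡⟨ collect (2 ^ n) ⟩
  4 * 2 ^ suc n                         ∎
  where
  open ≤-Reasoning
  expand : ∀ n → suc (suc n) * suc (suc n) ≡ suc n * suc n + (2 * suc n + 1)
  expand = solve-∀
  collect : ∀ a → 4 * a + (2 * a + 2 * a) ≡ 4 * (2 * a)
  collect = solve-∀
  n<2^n : ∀ n → n < 2 ^ n
  n<2^n zero    = s≤s z≤n
  n<2^n (suc n) = begin
    1 + suc n           ≤⟨ +-mono-≤ (m^n>0 2 n) (n<2^n n) ⟩
    2 ^ n + 2 ^ n       ≡⟨ cong (2 ^ n +_) (+-identityʳ _) ⟨
    2 ^ suc n           ∎

-- The levels contribute `κ + 2` each, in total a quadratic term: κ (κ + 2) + 1 = (κ + 1)² ≤ 4 · 2 ^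
-- κ. Hence 84 = 80 + 4.
overhead : ∀ {γ κ i E} → 84 ≤ γ → i ≤ κ → E ≤ 80 * 2 ^ κ + suc (i * (κ + 2)) → E ≤ γ * 2 ^ κ
overhead {γ} {κ} {i} {E} 84≤γ i≤κ E≤ = begin
  E                                ≤⟨ E≤ ⟩
  80 * 2 ^ κ + suc (i * (κ + 2))   ≤⟨ +-monoʳ-≤ (80 * 2 ^ κ) (s≤s (*-monoˡ-≤ (κ + 2) i≤κ)) ⟩
  80 * 2 ^ κ + suc (κ * (κ + 2))   ≡⟨ cong (80 * 2 ^ κ +_) (square κ) ⟩
  80 * 2 ^ κ + suc κ * suc κ       ≤⟨ +-monoʳ-≤ (80 * 2 ^ κ) (square≤2^ κ) ⟩
  80 * 2 ^ κ + 4 * 2 ^ κ           ≡⟨ *-distribʳ-+ (2 ^ κ) 80 4 ⟨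
  84 * 2 ^ κ                       ≤⟨ *-monoˡ-≤ (2 ^ κ) 84≤γ ⟩
  γ * 2 ^ κ                        ∎
  where
  open ≤-Reasoning
  square : ∀ κ → suc (κ * (κ + 2)) ≡ suc κ * suc κ
  square = solve-∀

-- The strict lower bound leaves room for the loop colour among 2 ^ κ colours; rounding up costs a
-- factor of two in the final exponent.
power-of-two-between : ∀ k → 0 < k → ∃[ κ ] k < 2 ^ κ × 2 ^ κ ≤ 2 * k
power-of-two-between (suc zero)    _ = 1 , ≤-refl , ≤-refl
power-of-two-between (suc (suc k)) _ with power-of-two-between (suc k) z<s
... | κ , lower , upper with m≤n⇒m<n∨m≡n lower
...   | inj₁ k<2^κ = κ , k<2^κ , ≤-trans upper (*-monoʳ-≤ 2 (n≤1+n (suc k)))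
...   | inj₂ k≡2^κ = suc κ , subst (_< 2 ^ suc κ) (sym k≡2^κ) (^-monoʳ-< 2 ≤-refl (n<1+n κ)) ,
                     ≤-reflexive (cong (2 *_) (sym k≡2^κ))

-- Reduction to smaller rainbow cliques

module Extremal {V C : Set} (_≟ⱽ_ : DecidableEquality V) (_≟_ : DecidableEquality C)
  (χ : V → V → C) (χ-sym : ∀ u v → χ u v ≡ χ v u)
  (o : C) (χ-diag : ∀ v → χ v v ≡ o) (χ-off : ∀ {u v} → χ u v ≡ o → u ≡ v)
  -- The excluded pattern is a 4-cycle a y b z in colour `c` whose diagonals a b and y z share a
  -- colour.
  (no-C₄ : ∀ {a b y z c} → a ≢ b → y ≢ z → c ≢ o →
           χ a y ≡ c → χ a z ≡ c → χ b y ≡ c → χ b z ≡ c → χ a b ≢ χ y z)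
  -- The exponent of the bound grows by `γ` for each colour of the palette, and 2 ^ κ bounds the
  -- number of all colours, loops included.
  (κ γ : ℕ) (colours : List C) (∈-colours : ∀ c → c ∈ colours) (length-colours : length colours ≤ 2 ^ κ)
  where

  open Rainbows _≟_ χ χ-sym o
  open DecMembership _≟_ using () renaming (_∉?_ to _∉ᶜ?_)
  open DecMembership _≟ⱽ_ using () renaming (_∉?_ to _∉ⱽ?_)

  Covers : List C → List V → Set
  Covers P W = ∀ {y z} → y ∈ W → z ∈ W → y ≢ z → χ y z ∈ P

  RainbowFree : ℕ → List V → Set
  RainbowFree m W = ∀ T → All (_∈ W) T → length T ≡ 2 ^ m → ¬ Rainbow T

  -- The palette `P` shrinks in the induction on colours while `κ` stays fixed, so the additive cost
  -- `E` may depend on `κ` and the level but not on the palette.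
  Bounded : ℕ → ℕ → Set
  Bounded m E = ∀ W P → Unique W → Covers P W → length P ≤ 2 ^ κ →
                RainbowFree m W → length W < 2 ^ (γ * length P + E)

  Covers-⊆ : ∀ {P W W′} → (∀ {y} → y ∈ W′ → y ∈ W) → Covers P W → Covers P W′
  Covers-⊆ sub cov y∈ z∈ = cov (sub y∈) (sub z∈)

  RainbowFree-⊆ : ∀ {m W W′} → (∀ {y} → y ∈ W′ → y ∈ W) → RainbowFree m W → RainbowFree m W′
  RainbowFree-⊆ sub free T T⊆ = free T (All.map sub T⊆)

  -- Two distinct vertices already form a rainbow clique of order 2, so `W` has at most one entry.
  bounded-pair : Bounded 1 1
  bounded-pair []           P _ _ _ _ = m^n>0 2 (γ * length P + 1)
  bounded-pair (_ ∷ [])     P _ _ _ _ = ^-monoʳ-≤ 2 (m≤n+m 1 (γ * length P))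
  bounded-pair (a ∷ b ∷ W) P ((a≢b ∷ _) ∷ _) _ _ free =
    contradiction (((λ ab≡o → a≢b (χ-off ab≡o)) ∷ []) ∷ [] ∷ [])
                  (free (a ∷ b ∷ []) (here refl ∷ there (here refl) ∷ []) refl)

  o∈cols : ∀ T → o ∈ cols T
  o∈cols []      = here refl
  o∈cols (v ∷ T) = ∈-++⁺ʳ (map (χ v) T) (o∈cols T)

  ∈-cols⁻ : ∀ {e} T → e ∈ cols T → e ≡ o ⊎ ∃[ a ] ∃[ b ] a ∈ T × b ∈ T × e ≡ χ a b
  ∈-cols⁻ []      (here eq) = inj₁ eq
  ∈-cols⁻ (v ∷ T) e∈ with ∈-++⁻ (map (χ v) T) e∈
  ... | inj₁ e∈v with ∈-map⁻ (χ v) e∈v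
  ...   | b , b∈ , eq = inj₂ (v , b , here refl , there b∈ , eq)
  ∈-cols⁻ (v ∷ T) e∈ | inj₂ e∈T with ∈-cols⁻ T e∈T
  ... | inj₁ eq = inj₁ eq
  ... | inj₂ (a , b , a∈ , b∈ , eq) = inj₂ (a , b , there a∈ , there b∈ , eq)

  unused : List V → List C → List C
  unused T = filter (_∉ᶜ? cols T)

  -- The r edge colours of `T` lie in `P`. Prepending `o` to `P` makes room for the seed of
  -- `cols T`; this is the `suc` that cancels.
  length-unused : ∀ {r T W P} → length (cols T) ≡ suc r → All (_∈ W) T → Covers P W → Rainbow T →
                  r + length (unused T P) ≤ length P
  length-unused {r} {T} {W} {P} len T⊆ cov rT = s≤s⁻¹ (begin
    suc r + length (unused T P)                  ≡⟨ cong₂ _+_ (sym len) (cong length (sym (filter-reject (_∉ᶜ? cols T) (λ o∉ → o∉ (o∈cols T))))) ⟩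
    length (cols T) + length (unused T (o ∷ P))  ≤⟨ UniqueCounting.length-unique-⊆ _≟_ (o ∷ P) rT cols⊆ ⟩
    suc (length P)                               ∎)
    where
    open ≤-Reasoning
    cols⊆ : ∀ {e} → e ∈ cols T → e ∈ o ∷ P
    cols⊆ e∈ with ∈-cols⁻ T e∈
    ... | inj₁ refl = here refl
    ... | inj₂ (a , b , a∈ , b∈ , refl) with a ≟ⱽ b
    ...   | yes refl = here (χ-diag a)
    ...   | no a≢b   = there (cov (All.lookup T⊆ a∈) (All.lookup T⊆ b∈) a≢b)

  -- A colour of T reappearing in the common neighbourhood would close a
  -- K₄ consisting of a 4-cycle in colour c and a matching in that colour.
  common-neighbours-covered : ∀ {c T W X P} → c ≢ o → (∀ {z} → z ∈ X → z ∈ W × All (λ y → χ y z ≡ c) T) →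
                              Covers P W → Covers (unused T P) X
  common-neighbours-covered {c} {T} c≢o X⊆ cov {y} {z} y∈ z∈ y≢z with X⊆ y∈ | X⊆ z∈
  ... | y∈W , Ty | z∈W , Tz = ∈-filter⁺ (_∉ᶜ? cols T) (cov y∈W z∈W y≢z) fresh
    where
    fresh : χ y z ∉ cols T
    fresh e∈ with ∈-cols⁻ T e∈
    ... | inj₁ eq = y≢z (χ-off eq)
    ... | inj₂ (a , b , a∈ , b∈ , eq) =
      no-C₄ a≢b y≢z c≢o (All.lookup Ty a∈) (All.lookup Tz a∈) (All.lookup Ty b∈) (All.lookup Tz b∈) (sym eq)
      where
      a≢b : a ≢ b
      a≢b refl = y≢z (χ-off (trans eq (χ-diag a)))

  heavy? : ∀ W Δ e y → Dec (Δ < star W y e)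
  heavy? W Δ e y = Δ <? star W y e

  -- Call a vertex light if all its colour degrees into `W` are at most `Δ`. More than t³ Δ light
  -- vertices would contain a rainbow clique of order t. So at least 2 ^ (u + κ) vertices are heavy
  -- in some colour, and one of the at most 2 ^ κ colours serves 2 ^ u of them.
  heavy-colour : ∀ t Δ u W → (∀ T → All (_∈ W) T → length T ≡ t → ¬ Rainbow T) →
                 t ^ 3 * Δ + 2 ^ (u + κ) ≤ length W →
                 ∃[ c ] 2 ^ u ≤ length (filter (heavy? W Δ c) W)
  heavy-colour t Δ u W free big
    with averaging colours (λ _ → 2 ^ u) (λ e → length (filter (heavy? W Δ e) W)) (∈-length (∈-colours o)) average
    where
    open ≤-Reasoning
    light? : ∀ y → Dec (All (λ e → star W y e ≤ Δ) colours)
    light? y = All.all? (λ e → star W y e ≤? Δ) colours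
    L = filter light? W
    L-small : length L ≤ t ^ 3 * Δ
    L-small = ≮⇒≥ λ large → impossible (rainbow-of-bounded-stars t Δ L stars large)
      where
      stars : ∀ {y} → y ∈ L → ∀ e → star L y e ≤ Δ
      stars y∈ e = ≤-trans (∑-filter-≤ light? W _)
                           (All.lookup (proj₂ (∈-filter⁻ light? {xs = W} y∈)) (∈-colours e))
      impossible : ¬ (∃[ T ] All (_∈ L) T × length T ≡ t × Rainbow T)
      impossible (T , T⊆ , len , rT) = free T (All.map (proj₁ ∘ ∈-filter⁻ light?) T⊆) len rT
    cover : ∀ y → 1 ≤ ⟦ light? y ⟧ + ∑ colours (λ e → ⟦ heavy? W Δ e y ⟧)
    cover y with toSum (light? y)
    ... | inj₁ light = ≤-trans (⟦⟧-intro (light? y) light) (m≤m+n _ _)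
    ... | inj₂ ¬light with find (Allₚ.¬All⇒Any¬ (λ e → star W y e ≤? Δ) colours ¬light)
    ...   | e , e∈ , heavy = ≤-trans (≤-trans (⟦⟧-intro (heavy? W Δ e y) (≰⇒> heavy)) (term≤∑ (λ e → ⟦ heavy? W Δ e y ⟧) e∈))
                                     (m≤n+m _ ⟦ light? y ⟧)
    total : length W ≤ t ^ 3 * Δ + ∑ colours (λ e → length (filter (heavy? W Δ e) W))
    total = begin
      length W                                                         ≡⟨ *-identityʳ _ ⟨
      length W * 1                                                     ≡⟨ ∑-const W 1 ⟨
      ∑ W (λ _ → 1)                                                    ≤⟨ ∑-mono W (λ {y} _ → cover y) ⟩
      ∑ W (λ y → ⟦ light? y ⟧ + ∑ colours (λ e → ⟦ heavy? W Δ e y ⟧))  ≡⟨ ∑-+ W _ _ ⟩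
      ∑ W (λ y → ⟦ light? y ⟧) + ∑ W (λ y → ∑ colours (λ e → ⟦ heavy? W Δ e y ⟧))
        ≡⟨ cong₂ _+_ (sym (length-filter-∑ light? W)) (∑-swap W colours _) ⟩
      length L + ∑ colours (λ e → ∑ W (λ y → ⟦ heavy? W Δ e y ⟧))
        ≤⟨ +-mono-≤ L-small (∑-mono colours λ {e} _ → ≤-reflexive (sym (length-filter-∑ (heavy? W Δ e) W))) ⟩
      t ^ 3 * Δ + ∑ colours (λ e → length (filter (heavy? W Δ e) W))   ∎
    average : ∑ colours (λ _ → 2 ^ u) ≤ ∑ colours (λ e → length (filter (heavy? W Δ e) W))
    average = begin
      ∑ colours (λ _ → 2 ^ u)  ≡⟨ ∑-const colours (2 ^ u) ⟩
      length colours * 2 ^ u   ≤⟨ *-monoˡ-≤ (2 ^ u) length-colours ⟩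
      2 ^ κ * 2 ^ u            ≡⟨ *-comm (2 ^ κ) (2 ^ u) ⟩
      2 ^ u * 2 ^ κ            ≡⟨ ^-distribˡ-+-* 2 u κ ⟨
      2 ^ (u + κ)              ≤⟨ +-cancelˡ-≤ (t ^ 3 * Δ) _ _ (≤-trans big total) ⟩
      ∑ colours (λ e → length (filter (heavy? W Δ e) W)) ∎
  ... | c , _ , large = c , large

  -- Colour `o` occurs on loops only and `W` lists each vertex once, so a star in colour `o` has at
  -- most one entry.
  heavy≢o : ∀ {Δ c W y} → Unique W → 1 ≤ Δ → Δ < star W y c → c ≢ o
  heavy≢o {W = W} {y} u 1≤Δ heavy refl = <⇒≱ heavy (≤-trans (≤-trans
    (∑-mono W (λ {w} _ → ⟦⟧-mono (χ y w ≟ o) (y ≟ⱽ w) χ-off))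
    (UniqueCounting.occurrences-unique _≟ⱽ_ u)) 1≤Δ)

  -- Here `r` is the number of edges of a clique of order 2 ^ m, `s` the number of dependent
  -- choices, and 2 ^ -ℓ the density of a heavy star.
  module Step (m E q r : ℕ) (pairs : 2 * r + 2 ^ m ≡ 2 ^ m * 2 ^ m) (1≤r : 1 ≤ r) (smaller : Bounded m E) where

    s ℓ E′ : ℕ
    s  = 2 ^ q
    -- This is 3 (m + 1) + 1: the cube of 2 ^ (m + 1) comes from the greedy bound, and one more bit
    -- confines the light vertices to half of `W`.
    ℓ  = 3 * m + 4
    -- One bit pays for the light half of `W`, κ bits for the choice of a colour, one for the
    -- doubling in `potential`, and ℓ for each of the `s` choices.
    E′ = E + (κ + 2 + ℓ * s)

    -- After `s` choices poor cliques are thinned out by 2 ^ (γ r s), which has to match the number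
    -- 2 ^ (u 2 ^ m) of tuples in `U`.
    module _ (budget : (γ * 2 ^ κ + E′) * 2 ^ m ≤ γ * r * s) where

      length-cols-clique : ∀ T → length T ≡ 2 ^ m → length (cols T) ≡ suc r
      length-cols-clique T len = *-cancelˡ-≡ (length (cols T)) (suc r) 2 (+-cancelʳ-≡ (2 ^ m) _ _ (begin
        2 * length (cols T) + 2 ^ m    ≡⟨ cong (2 * length (cols T) +_) len ⟨
        2 * length (cols T) + length T ≡⟨ length-cols T ⟩
        2 + length T * length T        ≡⟨ cong (λ t → 2 + t * t) len ⟩
        2 + 2 ^ m * 2 ^ m              ≡⟨ cong (2 +_) pairs ⟨
        2 + (2 * r + 2 ^ m)            ≡⟨ regroup r (2 ^ m) ⟩
        2 * suc r + 2 ^ m              ∎))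
        where
        open ≡-Reasoning
        regroup : ∀ r t → 2 + (2 * r + t) ≡ 2 * suc r + t
        regroup = solve-∀

      module _ (W : List V) (P : List C) (uW : Unique W) (cov : Covers P W) (P≤ : length P ≤ 2 ^ κ)
        (free : RainbowFree (suc m) W)
        -- Inner induction on the number of colours, at the same level m + 1.
        (ih : ∀ X P′ → length P′ < length P → Unique X → Covers P′ X → length P′ ≤ 2 ^ κ →
              RainbowFree (suc m) X → length X < 2 ^ (γ * length P′ + E′))
        -- The size is exactly the one to be refuted, so that densities in `W` become differences of
        -- exponents.
        (length-W : length W ≡ 2 ^ (γ * length P + E′)) where

        private
          j ρ u N δ : ℕ
          j = length P
          ρ = γ * j + E
          u = suc (ρ + ℓ * s)
          N = γ * j + E′
          δ = N ∸ ℓ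

          N≡1+u+κ : N ≡ suc (u + κ)
          N≡1+u+κ = regroup (γ * j) E κ (ℓ * s)
            where
            regroup : ∀ a E κ b → a + (E + (κ + 2 + b)) ≡ suc (suc (a + E + b) + κ)
            regroup = solve-∀

          -- The subtraction in `δ` does not truncate, since ℓ ≤ ℓ s ≤ N.
          ℓ+δ≡N : ℓ + δ ≡ N
          ℓ+δ≡N = m+[n∸m]≡n (begin
            ℓ                           ≤⟨ m≤m*n ℓ s {{m^n≢0 2 q}} ⟩
            ℓ * s                       ≤⟨ m≤n+m (ℓ * s) (κ + 2) ⟩
            κ + 2 + ℓ * s               ≤⟨ m≤n+m _ E ⟩
            E′                          ≤⟨ m≤n+m E′ (γ * j) ⟩
            N                           ∎)
            where open ≤-Reasoning

          halves : (2 ^ suc m) ^ 3 * 2 ^ δ + 2 ^ (u + κ) ≤ length W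
          halves = ≤-reflexive (begin
            (2 ^ suc m) ^ 3 * 2 ^ δ + 2 ^ (u + κ)  ≡⟨ cong (λ a → a * 2 ^ δ + 2 ^ (u + κ)) (^-*-assoc 2 (suc m) 3) ⟩
            2 ^ (suc m * 3) * 2 ^ δ + 2 ^ (u + κ)  ≡⟨ cong (_+ 2 ^ (u + κ)) (^-distribˡ-+-* 2 (suc m * 3) δ) ⟨
            2 ^ (suc m * 3 + δ) + 2 ^ (u + κ)      ≡⟨ cong (λ a → 2 ^ a + 2 ^ (u + κ)) (suc-injective (trans (regroup m δ) (trans ℓ+δ≡N N≡1+u+κ))) ⟩
            2 ^ (u + κ) + 2 ^ (u + κ)              ≡⟨ cong (2 ^ (u + κ) +_) (+-identityʳ _) ⟨
            2 ^ suc (u + κ)                        ≡⟨ cong (2 ^_) N≡1+u+κ ⟨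
            2 ^ N                                  ≡⟨ length-W ⟨
            length W                               ∎)
            where
            open ≡-Reasoning
            regroup : ∀ m δ → suc (suc m * 3 + δ) ≡ 3 * m + 4 + δ
            regroup = solve-∀

        module Choice (c : C) (c≢o : c ≢ o) (U : List V) (uU : Unique U) (length-U : length U ≡ 2 ^ u)
          (U⊆W : All (_∈ W) U) (rich : All (λ y → 2 ^ δ < star W y c) U) where

          open DependentChoice (λ y z → χ y z ≟ c) W

          cliques : List (List V)
          cliques = filter rainbow? (tuples (2 ^ m) U)

          -- The common neighbourhood of `T` in colour `c` has lost the r colours of `T`, so `ih`
          -- bounds it by 2 ^ (γ (j - r) + E′), a 2 ^ -(γ r) fraction of `W`. It applies because r
          -- is positive.
          cliques-poor : ∀ {T} → T ∈ cliques → codegree T * 2 ^ (γ * r) ≤ length W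
          cliques-poor {T} T∈ with ∈-filter⁻ rainbow? {xs = tuples (2 ^ m) U} T∈
          ... | T∈tuples , rT with ∈-tuples⁻ (2 ^ m) T∈tuples
          ...   | len , T⊆U = begin
            codegree T * 2 ^ (γ * r)                              ≡⟨ cong (_* 2 ^ (γ * r)) (length-filter-∑ (common? T) W) ⟨
            length X * 2 ^ (γ * r)                                ≤⟨ *-monoˡ-≤ (2 ^ (γ * r)) (<⇒≤ X-small) ⟩
            2 ^ (γ * length (unused T P) + E′) * 2 ^ (γ * r)      ≡⟨ ^-distribˡ-+-* 2 (γ * length (unused T P) + E′) (γ * r) ⟨
            2 ^ (γ * length (unused T P) + E′ + γ * r)            ≡⟨ cong (2 ^_) (regroup γ (length (unused T P)) E′ r) ⟩
            2 ^ (γ * (r + length (unused T P)) + E′)              ≤⟨ ^-monoʳ-≤ 2 (+-monoˡ-≤ E′ (*-monoʳ-≤ γ fewer)) ⟩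
            2 ^ N                                                 ≡⟨ length-W ⟨
            length W                                              ∎
            where
            open ≤-Reasoning
            X = filter (common? T) W
            X⊆ : ∀ {z} → z ∈ X → z ∈ W × All (λ y → χ y z ≡ c) T
            X⊆ = ∈-filter⁻ (common? T)
            fewer : r + length (unused T P) ≤ length P
            fewer = length-unused {P = P} (length-cols-clique T len) (All.map (All.lookup U⊆W) T⊆U) cov rT
            X-small : length X < 2 ^ (γ * length (unused T P) + E′)
            X-small = ih X (unused T P) (≤-trans (+-monoˡ-≤ _ 1≤r) fewer) (Uniqueₚ.filter⁺ (common? T) uW)
              (common-neighbours-covered c≢o X⊆ cov)
              (≤-trans (m+n≤o⇒n≤o r fewer) P≤) (RainbowFree-⊆ {suc m} (proj₁ ∘ X⊆) free)
            regroup : ∀ γ a E r → γ * a + E + γ * r ≡ γ * (r + a) + E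
            regroup = solve-∀

          degrees : All (λ y → length W ≤ degree y * 2 ^ ℓ) U
          degrees = All.map (λ {y} heavy → begin
            length W            ≡⟨ length-W ⟩
            2 ^ N               ≡⟨ cong (2 ^_) (trans (sym ℓ+δ≡N) (+-comm ℓ δ)) ⟩
            2 ^ (δ + ℓ)         ≡⟨ ^-distribˡ-+-* 2 δ ℓ ⟩
            2 ^ δ * 2 ^ ℓ       ≤⟨ *-monoˡ-≤ (2 ^ ℓ) (<⇒≤ heavy) ⟩
            degree y * 2 ^ ℓ    ∎) rich
            where open ≤-Reasoning

          exponents : u * 2 ^ m ≤ γ * r * s
          exponents = begin
            u * 2 ^ m                   ≤⟨ *-monoˡ-≤ (2 ^ m) (≤-trans (≤-trans (m≤m+n u κ) (n≤1+n _)) (≤-reflexive (sym N≡1+u+κ))) ⟩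
            N * 2 ^ m                   ≤⟨ *-monoˡ-≤ (2 ^ m) (+-monoˡ-≤ E′ (*-monoʳ-≤ γ P≤)) ⟩
            (γ * 2 ^ κ + E′) * 2 ^ m    ≤⟨ budget ⟩
            γ * r * s                   ∎
            where open ≤-Reasoning

          -- There are at most 2 ^ (γ r s) cliques, so the first summand does not exceed the second;
          -- twice the second is the right-hand side by the choice of `u`.
          potential : length cliques * (2 ^ ℓ) ^ s + 2 ^ ρ * ((2 ^ (γ * r)) ^ s * (2 ^ ℓ) ^ s)
                      ≤ length U * (2 ^ (γ * r)) ^ s
          potential rewrite ^-*-assoc 2 ℓ s | ^-*-assoc 2 (γ * r) s = begin
            length cliques * 2 ^ (ℓ * s) + 2 ^ ρ * (2 ^ (γ * r * s) * 2 ^ (ℓ * s))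
              ≤⟨ +-monoˡ-≤ _ (*-monoˡ-≤ (2 ^ (ℓ * s)) few) ⟩
            2 ^ (γ * r * s) * 2 ^ (ℓ * s) + 2 ^ ρ * (2 ^ (γ * r * s) * 2 ^ (ℓ * s))
              ≤⟨ +-monoˡ-≤ _ (m≤n*m _ (2 ^ ρ) {{m^n≢0 2 ρ}}) ⟩
            2 ^ ρ * (2 ^ (γ * r * s) * 2 ^ (ℓ * s)) + 2 ^ ρ * (2 ^ (γ * r * s) * 2 ^ (ℓ * s))
              ≡⟨ regroup (2 ^ ρ) (2 ^ (γ * r * s)) (2 ^ (ℓ * s)) ⟩
            2 * (2 ^ ρ * 2 ^ (ℓ * s)) * 2 ^ (γ * r * s)
              ≡⟨ cong (λ a → 2 * a * 2 ^ (γ * r * s)) (^-distribˡ-+-* 2 ρ (ℓ * s)) ⟨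
            2 ^ u * 2 ^ (γ * r * s)
              ≡⟨ cong (_* 2 ^ (γ * r * s)) length-U ⟨
            length U * 2 ^ (γ * r * s) ∎
            where
            open ≤-Reasoning
            regroup : ∀ a b d → a * (b * d) + a * (b * d) ≡ 2 * (a * d) * b
            regroup = solve-∀
            few : length cliques ≤ 2 ^ (γ * r * s)
            few = begin
              length cliques                 ≤⟨ length-filter rainbow? (tuples (2 ^ m) U) ⟩
              length (tuples (2 ^ m) U)      ≡⟨ length-tuples (2 ^ m) U ⟩
              length U ^ (2 ^ m)             ≡⟨ cong (_^ (2 ^ m)) length-U ⟩
              (2 ^ u) ^ (2 ^ m)              ≡⟨ ^-*-assoc 2 u (2 ^ m) ⟩
              2 ^ (u * 2 ^ m)                ≤⟨ ^-monoʳ-≤ 2 exponents ⟩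
              2 ^ (γ * r * s)                ∎

          -- Deleting the heads of the surviving cliques leaves at least 2 ^ ρ vertices without a
          -- rainbow clique of order 2 ^ m, whereas `smaller` allows fewer than 2 ^ ρ.
          impossible : ⊥
          impossible
            with dependent-choice s {2 ^ (γ * r)} {2 ^ ℓ} {2 ^ ρ} {{m^n≢0 2 (γ * r)}} {{m^n≢0 2 ℓ}} U cliques uU
                   (subst (0 <_) (sym length-W) (m^n>0 2 N)) degrees (All.tabulate cliques-poor) potential
          ... | Y , bad , uY , Y⊆U , keep , many with heads bad
          ...   | H , H≤ , hit = <⇒≱ Z-small Z-large
            where
            Z = filter (_∉ⱽ? H) Y
            Z⊆Y : ∀ {y} → y ∈ Z → y ∈ Y × y ∉ H
            Z⊆Y = ∈-filter⁻ (_∉ⱽ? H)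
            Z-large : 2 ^ ρ ≤ length Z
            Z-large = +-cancelˡ-≤ (length bad) _ _ (begin
              length bad + 2 ^ ρ      ≤⟨ many ⟩
              length Y                ≤⟨ UniqueCounting.length-remove _≟ⱽ_ H uY ⟩
              length H + length Z     ≤⟨ +-monoˡ-≤ (length Z) H≤ ⟩
              length bad + length Z   ∎)
              where open ≤-Reasoning
            Z-free : RainbowFree m Z
            Z-free []      _           len _  = <⇒≢ (m^n>0 2 m) len
            Z-free (v ∷ T) (v∈ ∷ T⊆) len rT = proj₂ (Z⊆Y v∈) (hit (keep clique T⊆Y))
              where
              T⊆Y : All (_∈ Y) (v ∷ T)
              T⊆Y = All.map (proj₁ ∘ Z⊆Y) (v∈ ∷ T⊆)
              clique : v ∷ T ∈ cliques
              clique = ∈-filter⁺ rainbow?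
                (subst (λ t → v ∷ T ∈ tuples t U) len (∈-tuples⁺ (All.map (All.lookup Y⊆U) T⊆Y))) rT
            Z-small : length Z < 2 ^ ρ
            Z-small = smaller Z P (Uniqueₚ.filter⁺ (_∉ⱽ? H) uY)
              (Covers-⊆ (All.lookup U⊆W ∘ All.lookup Y⊆U ∘ proj₁ ∘ Z⊆Y) cov) P≤ Z-free

        not-exact : ⊥
        not-exact with heavy-colour (2 ^ suc m) (2 ^ δ) u W free halves
        ... | c , large = Choice.impossible c c≢o U
                (Uniqueₚ.take⁺ (2 ^ u) (Uniqueₚ.filter⁺ (heavy? W (2 ^ δ) c) uW)) length-U
                (All.map proj₁ U⊆) (All.map proj₂ U⊆)
          where
          U = take (2 ^ u) (filter (heavy? W (2 ^ δ) c) W)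
          length-U : length U ≡ 2 ^ u
          length-U = length-take-≤ (filter (heavy? W (2 ^ δ) c) W) large
          U⊆ : All (λ y → y ∈ W × 2 ^ δ < star W y c) U
          U⊆ = All.tabulate (∈-filter⁻ (heavy? W (2 ^ δ) c) ∘ ∈-take⁻ (2 ^ u))
          c≢o : c ≢ o
          -- `U` is nonempty, and its first vertex, being heavy in `c`, rules out the loop colour.
          c≢o with U | U⊆ | length-U
          ... | []    | _           | 0≡ = contradiction 0≡ (<⇒≢ (m^n>0 2 u))
          ... | _ ∷ _ | (_ , h) ∷ _ | _  = heavy≢o uW (m^n>0 2 δ) h

      -- Strong induction on the size of the palette, through the bound `b`. A list that is too long
      -- is truncated to exactly `n` entries, which preserves the hypotheses.
      bounded-step : Bounded (suc m) E′
      bounded-step W P = go (suc (length P)) W P ≤-refl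
        where
        go : ∀ b W P → length P < b → Unique W → Covers P W → length P ≤ 2 ^ κ →
             RainbowFree (suc m) W → length W < 2 ^ (γ * length P + E′)
        go (suc b) W P P<b uW cov P≤ free = ≰⇒> λ large →
          not-exact (take n W) P (Uniqueₚ.take⁺ n uW) (Covers-⊆ (∈-take⁻ n) cov) P≤
            (RainbowFree-⊆ {suc m} (∈-take⁻ n) free)
            (λ X P′ P′<P → go b X P′ (<-≤-trans P′<P (s≤s⁻¹ P<b)))
            (length-take-≤ W large)
          where n = 2 ^ (γ * length P + E′)

  -- Summation over the levels

  length-cols-≥ : ∀ T → length T ≤ length (cols T)
  length-cols-≥ []      = z≤n
  length-cols-≥ (v ∷ T) = begin
    suc (length T)             ≡⟨ +-comm 1 (length T) ⟩
    length T + 1               ≤⟨ +-monoʳ-≤ (length T) (∈-length (o∈cols T)) ⟩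
    length T + length (cols T) ≡⟨ length-cols-∷ v T ⟨
    length (cols (v ∷ T))      ∎
    where open ≤-Reasoning

  -- A rainbow clique of order 2 ^ (κ + 1) shows at least that many distinct colours, the loop
  -- colour included, but there are at most 2 ^ κ.
  rainbowFree : ∀ W → RainbowFree (suc κ) W
  rainbowFree W T _ len rT = <⇒≱ (^-monoʳ-< 2 ≤-refl (n<1+n κ)) (begin
    2 ^ suc κ                     ≡⟨ len ⟨
    length T                      ≤⟨ length-cols-≥ T ⟩
    length (cols T)               ≤⟨ m≤m+n _ _ ⟩
    length (cols T) + length (unused T colours) ≤⟨ UniqueCounting.length-unique-⊆ _≟_ colours rT (λ {e} _ → ∈-colours e) ⟩
    length colours                ≤⟨ length-colours ⟩
    2 ^ κ                         ∎)
    where open ≤-Reasoning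

  -- (6 i + 20) 2 ^ q is the tail, from level i on, of the series of all
  -- increments (3 (i + 1) + 4) 2 ^ q; at i = 0 it equals 80 · 2 ^ κ.
  bounded-levels : 84 ≤ γ → ∀ i q → i + q ≡ κ + 2 → i ≤ κ →
    ∃[ E ] Bounded (suc i) E × E + (6 * i + 20) * 2 ^ q ≤ 80 * 2 ^ κ + suc (i * (κ + 2))
  bounded-levels 84≤γ zero    q refl _ = 1 , bounded-pair , ≤-reflexive (begin
    1 + 20 * 2 ^ (κ + 2)      ≡⟨ cong (λ a → 1 + 20 * a) (^-distribˡ-+-* 2 κ 2) ⟩
    1 + 20 * (2 ^ κ * 4)      ≡⟨ regroup (2 ^ κ) ⟩
    80 * 2 ^ κ + 1            ∎)
    where
    open ≡-Reasoning
    regroup : ∀ a → 1 + 20 * (a * 4) ≡ 80 * a + 1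
    regroup = solve-∀
  bounded-levels 84≤γ (suc i) q i+q i<κ with bounded-levels 84≤γ i (suc q) (trans (+-suc i q) i+q) (<⇒≤ i<κ)
  ... | E , bounded , E≤ =
    Step.E′ (suc i) E (suc q) r pairs 1≤r bounded , Step.bounded-step (suc i) E (suc q) r pairs 1≤r bounded budget , E′-tail
    where
    open ≤-Reasoning
    x = 2 ^ i
    -- This is x (2x - 1), the number of edges of a clique of order 2x = 2 ^ (i + 1).
    r = x * (x + pred x)
    E′ = E + (κ + 2 + (3 * suc i + 4) * 2 ^ suc q)

    x≡ : suc (pred x) ≡ x
    x≡ = suc-pred x {{m^n≢0 2 i}}

    pairs : 2 * r + 2 ^ suc i ≡ 2 ^ suc i * 2 ^ suc i
    pairs = subst (λ x → 2 * (x * (x + pred x)) + 2 * x ≡ (2 * x) * (2 * x)) x≡ (square (pred x))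
      where
      square : ∀ y → 2 * (suc y * (suc y + y)) + 2 * suc y ≡ (2 * suc y) * (2 * suc y)
      square = solve-∀

    1≤r : 1 ≤ r
    1≤r = *-mono-≤ (m^n>0 2 i) (≤-trans (m^n>0 2 i) (m≤m+n x (pred x)))

    E′-tail : E′ + (6 * suc i + 20) * 2 ^ q ≤ 80 * 2 ^ κ + suc (suc i * (κ + 2))
    E′-tail = begin
      E′ + (6 * suc i + 20) * 2 ^ q                   ≡⟨ regroup E κ i (2 ^ q) ⟩
      E + (6 * i + 20) * 2 ^ suc q + (κ + 2)          ≤⟨ +-monoˡ-≤ (κ + 2) E≤ ⟩
      80 * 2 ^ κ + suc (i * (κ + 2)) + (κ + 2)        ≡⟨ collect (80 * 2 ^ κ) (i * (κ + 2)) (κ + 2) ⟩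
      80 * 2 ^ κ + suc (suc i * (κ + 2))              ∎
      where
      regroup : ∀ E κ i a → E + (κ + 2 + (3 * suc i + 4) * (2 * a)) + (6 * suc i + 20) * a
                          ≡ E + (6 * i + 20) * (2 * a) + (κ + 2)
      regroup = solve-∀
      collect : ∀ a b d → a + suc b + d ≡ a + suc (d + b)
      collect = solve-∀

    E′≤ : E′ ≤ γ * 2 ^ κ
    E′≤ = overhead {κ = κ} 84≤γ i<κ (m+n≤o⇒m≤o E′ E′-tail)

    -- The number s = 2 ^ (q + 1) of choices satisfies x s = 4 · 2 ^ κ. By `E′≤` the left side is at
    -- most 4 γ x 2 ^ κ = γ x² s, and x² ≤ r.
    budget : (γ * 2 ^ κ + E′) * 2 ^ suc i ≤ γ * r * 2 ^ suc q
    budget = begin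
      (γ * 2 ^ κ + E′) * (2 * x)            ≤⟨ *-monoˡ-≤ (2 * x) (+-monoʳ-≤ (γ * 2 ^ κ) E′≤) ⟩
      (γ * 2 ^ κ + γ * 2 ^ κ) * (2 * x)     ≡⟨ regroup₁ γ (2 ^ κ) x ⟩
      γ * x * (2 ^ κ * 4)                   ≡⟨ cong (γ * x *_) (^-distribˡ-+-* 2 κ 2) ⟨
      γ * x * 2 ^ (κ + 2)                   ≡⟨ cong (λ a → γ * x * 2 ^ a) (trans (+-suc i q) i+q) ⟨
      γ * x * 2 ^ (i + suc q)               ≡⟨ cong (γ * x *_) (^-distribˡ-+-* 2 i (suc q)) ⟩
      γ * x * (x * 2 ^ suc q)               ≡⟨ regroup₂ γ x (2 ^ suc q) ⟩
      γ * (x * x) * 2 ^ suc q               ≤⟨ *-monoˡ-≤ (2 ^ suc q) (*-monoʳ-≤ γ (*-monoʳ-≤ x (m≤m+n x (pred x)))) ⟩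
      γ * r * 2 ^ suc q                     ∎
      where
      regroup₁ : ∀ γ a x → (γ * a + γ * a) * (2 * x) ≡ γ * x * (a * 4)
      regroup₁ = solve-∀
      regroup₂ : ∀ γ x b → γ * x * (x * b) ≡ γ * (x * x) * b
      regroup₂ = solve-∀

  -- At level κ + 1 rainbow cliques are excluded by the number of colours alone; palette and
  -- overhead each contribute at most γ 2 ^ κ to the exponent.
  vertex-bound : 84 ≤ γ → ∀ W → Unique W → length W < 2 ^ ((γ + γ) * 2 ^ κ)
  vertex-bound 84≤γ W uW with bounded-levels 84≤γ κ 2 refl ≤-refl
  ... | E , bounded , E≤ = begin-strict
    length W                       <⟨ bounded W colours uW (λ _ _ _ → ∈-colours _) length-colours (rainbowFree W) ⟩
    2 ^ (γ * length colours + E)   ≤⟨ ^-monoʳ-≤ 2 (+-mono-≤ (*-monoʳ-≤ γ length-colours) (overhead {κ = κ} 84≤γ ≤-refl (m+n≤o⇒m≤o E E≤))) ⟩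
    2 ^ (γ * 2 ^ κ + γ * 2 ^ κ)    ≡⟨ cong (2 ^_) (*-distribʳ-+ (2 ^ κ) γ γ) ⟨
    2 ^ ((γ + γ) * 2 ^ κ)          ∎
    where open ≤-Reasoning

-- The colouring of a complete graph

module _ {n k : ℕ} (χ : EdgeColoring n k) where

  -- Decidability makes the final argument by contradiction constructive.
  hasBadK4? : Dec (HasBadK4 χ)
  hasBadK4? =
    Fin.any? λ a → Fin.any? λ b → Fin.any? λ c → Fin.any? λ d →
      (a ≢? b ×-dec a ≢? c ×-dec a ≢? d ×-dec b ≢? c ×-dec b ≢? d ×-dec c ≢? d) ×-dec
      (Fin.any? λ x → Fin.any? λ y →
        (col χ a b ∈₂? x , y) ×-dec (col χ a c ∈₂? x , y) ×-dec (col χ a d ∈₂? x , y) ×-dec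
        (col χ b c ∈₂? x , y) ×-dec (col χ b d ∈₂? x , y) ×-dec (col χ c d ∈₂? x , y))
    where
    infix 4 _≢?_
    _≢?_ : ∀ {m} (i j : Fin m) → Dec (i ≢ j)
    i ≢? j = ¬? (i Fin.≟ j)
    _∈₂?_,_ : ∀ {m} (x a b : Fin m) → Dec (x ∈₂ a , b)
    x ∈₂? a , b = (x Fin.≟ a) ⊎-dec (x Fin.≟ b)

  -- Loops receive a colour of their own, since the diagonal values of `χ` are arbitrary; colour
  -- `zero` then detects equality of vertices.
  colour⁺ : ∀ {u v} → Dec (u ≡ v) → Fin (suc k)
  colour⁺         (yes _) = zero
  colour⁺ {u} {v} (no _)  = suc (col χ u v)

  col⁺ : Fin n → Fin n → Fin (suc k)
  col⁺ u v = colour⁺ (u Fin.≟ v)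

  col⁺-sym : ∀ u v → col⁺ u v ≡ col⁺ v u
  col⁺-sym u v with u Fin.≟ v | v Fin.≟ u
  ... | yes _   | yes _   = refl
  ... | no _    | no _    = cong suc (symm χ u v)
  ... | yes u≡v | no v≢u  = contradiction (sym u≡v) v≢u
  ... | no u≢v  | yes v≡u = contradiction (sym v≡u) u≢v

  col⁺-diag : ∀ v → col⁺ v v ≡ zero
  col⁺-diag v with v Fin.≟ v
  ... | yes _  = refl
  ... | no v≢v = contradiction refl v≢v

  col⁺-off : ∀ {u v} → col⁺ u v ≡ zero → u ≡ v
  col⁺-off {u} {v} eq with u Fin.≟ v
  ... | yes u≡v = u≡v

  col⁺-suc : ∀ {u v c} → col⁺ u v ≡ suc c → u ≢ v × col χ u v ≡ c
  col⁺-suc {u} {v} eq with u Fin.≟ v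
  col⁺-suc refl | no u≢v = u≢v , refl

  col⁺-≢ : ∀ {u v} → u ≢ v → col⁺ u v ≡ suc (col χ u v)
  col⁺-≢ {u} {v} u≢v with u Fin.≟ v
  ... | yes u≡v = contradiction u≡v u≢v
  ... | no _    = refl

  -- The cycle edges have colour `c` and the two diagonals share `col χ a b`. Since `c` is not
  -- `zero`, no cycle edge is a loop, so the four vertices are distinct.
  col⁺-C₄ : ¬ HasBadK4 χ → ∀ {a b y z c} → a ≢ b → y ≢ z → c ≢ zero →
            col⁺ a y ≡ c → col⁺ a z ≡ c → col⁺ b y ≡ c → col⁺ b z ≡ c → col⁺ a b ≢ col⁺ y z
  col⁺-C₄ ¬bad {c = zero}  _ _ c≢0 = contradiction refl c≢0
  col⁺-C₄ ¬bad {a} {b} {y} {z} {suc c} a≢b y≢z _ ay az by bz ab≡yz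
    with col⁺-suc ay | col⁺-suc az | col⁺-suc by | col⁺-suc bz
  ... | a≢y , ay≡c | a≢z , az≡c | b≢y , by≡c | b≢z , bz≡c =
    ¬bad (a , b , y , z , (a≢b , a≢y , a≢z , b≢y , b≢z , y≢z) ,
          col χ a b , c , inj₁ refl , inj₂ ay≡c , inj₂ az≡c , inj₂ by≡c , inj₂ bz≡c ,
          inj₁ (Fin.suc-injective (trans (sym (col⁺-≢ y≢z)) (trans (sym ab≡yz) (col⁺-≢ a≢b)))))

theorem1p1 : (k : ℕ) → 2 ^ 100 < k → (n : ℕ) → 2 ^ (2000 * k) ≤ n →
    (χ : EdgeColoring n k) → HasBadK4 χ
theorem1p1 k 2^100<k n n-large χ with hasBadK4? χ
... | yes bad = bad
... | no ¬bad with power-of-two-between k (≤-<-trans z≤n 2^100<k)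
...   | κ , k<2^κ , 2^κ≤2k = contradiction n-large (<⇒≱ (begin-strict
    n                        ≡⟨ length-tabulate {n = n} (λ v → v) ⟨
    -- With γ = 500 = 84 + 416 the exponent 2 γ 2 ^ κ is at most 2000 k.
    length (allFin n)        <⟨ vertex-bound (m≤m+n 84 416) (allFin n) (Uniqueₚ.allFin⁺ n) ⟩
    2 ^ (1000 * 2 ^ κ)       ≤⟨ ^-monoʳ-≤ 2 (*-monoʳ-≤ 1000 2^κ≤2k) ⟩
    2 ^ (1000 * (2 * k))     ≡⟨ cong (2 ^_) (*-assoc 1000 2 k) ⟨
    2 ^ (2000 * k)           ∎))
  where
  open ≤-Reasoning
  open Extremal Fin._≟_ Fin._≟_ (col⁺ χ) (col⁺-sym χ) zero (col⁺-diag χ) (col⁺-off χ) (col⁺-C₄ χ ¬bad)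
    κ 500 (allFin (suc k)) ∈-allFin (≤-trans (≤-reflexive (length-tabulate {n = suc k} (λ c → c))) k<2^κ)
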